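{- Let $G$ be a finite simple graph with at least one edge, and let $\phi$ be a semi-transitive orientation of $G$. Then there exists an edge $e\in E(G)$ such that the restriction of $\phi$ to $G\setminus e$ is a semi-transitive orientation of $G\setminus e$.
   Context: Graphs are finite, undirected and simple. An orientation of a graph assigns to each edge one of its two directions; it is acyclic if it has no directed cycle. A digraph is transitive if whenever $v_1\to v_2$ and $v_2\to v_3$ are directed edges on three distinct vertices, $v_1\to v_3$ is also a directed edge. Given an acyclic orientation $\phi$ of a graph $G$, a shortcut in $\phi(G)$ is a non-transitive induced subdigraph of $\phi(G)$ on a vertex set $\{v_1,\dots,v_n\}$ with $n\ge 4$ (distinct vertices) that contains the directed path $v_1\to v_2\to\cdots\to v_n$ and the directed edge $v_1\to v_n$. An acyclic orientation $\phi$ is semi-transitive if $\phi(G)$ contains no shortcut. $G\setminus e$ denotes the graph obtained from $G$ by deleting the edge $e$ (keeping all vertices). -}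

module Defs where

open import Data.Fin using (Fin; zero; suc; inject₁; fromℕ)
open import Data.Fin.Properties using (_≟_)
open import Data.Nat using (ℕ; _≤_) renaming (suc to sucℕ)
open import Data.Product using (_×_; _,_; proj₁)
open import Data.Sum as Sum using (_⊎_; inj₁; inj₂)
open import Function using (_∘_; _on_)
open import Function.Definitions using (Injective)
open import Level using (0ℓ)
open import Relation.Binary.Core using (Rel)
open import Relation.Binary.Definitions using (Symmetric; Asymmetric; Decidable)
open import Relation.Binary.PropositionalEquality using (_≡_; _≢_)
open import Relation.Nullary using (¬_)
open import Relation.Nullary.Decidable using (_×-dec_; _⊎-dec_; ¬?)

record Graph (n : ℕ) : Set₁ where
  field
    Adj    : Rel (Fin n) 0ℓ
    adj?   : Decidable Adj
    sym    : Symmetric Adj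
    noLoop : ∀ {u} → ¬ Adj u u

-- An edge is named by its endpoints in some order: (a , b) and (b , a) name
-- the same edge, and Joins does not distinguish them.
record Edge {n : ℕ} (G : Graph n) : Set where
  constructor edge
  field
    {end₁ end₂} : Fin n
    adjacent    : Graph.Adj G end₁ end₂

Joins : ∀ {n} {G : Graph n} → Edge G → Rel (Fin n) 0ℓ
Joins e u v = (u ≡ end₁ × v ≡ end₂) ⊎ (u ≡ end₂ × v ≡ end₁)
  where open Edge e

joins? : ∀ {n} {G : Graph n} (e : Edge G) → Decidable (Joins e)
joins? e u v = ((u ≟ end₁) ×-dec (v ≟ end₂)) ⊎-dec ((u ≟ end₂) ×-dec (v ≟ end₁))
  where open Edge e

joins-sym : ∀ {n} {G : Graph n} (e : Edge G) → Symmetric (Joins e)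
joins-sym e (inj₁ (p , q)) = inj₂ (q , p)
joins-sym e (inj₂ (p , q)) = inj₁ (q , p)

infixl 6 _∖_

_∖_ : ∀ {n} (G : Graph n) → Edge G → Graph n
G ∖ e = record
  { Adj    = λ u v → Adj u v × ¬ Joins e u v
  ; adj?   = λ u v → adj? u v ×-dec ¬? (joins? e u v)
  ; sym    = λ (a , ¬j) → sym a , ¬j ∘ joins-sym e
  ; noLoop = noLoop ∘ proj₁
  }
  where open Graph G

-- Each edge gets exactly one of its two directions: `covers` gives at least
-- one, `asym` at most one, and `sound` says that only edges are directed.
record Orientation {n : ℕ} (G : Graph n) : Set₁ where
  open Graph G using (Adj)
  infix 4 _⟶_
  field
    _⟶_    : Rel (Fin n) 0ℓ
    sound  : ∀ {u v} → u ⟶ v → Adj u v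
    covers : ∀ {u v} → Adj u v → (u ⟶ v) ⊎ (v ⟶ u)
    asym   : Asymmetric _⟶_

restrict : ∀ {n} {G : Graph n} → Orientation G → (e : Edge G) → Orientation (G ∖ e)
restrict φ e = record
  { _⟶_    = λ u v → (u ⟶ v) × ¬ Joins e u v
  ; sound  = λ (a , ¬j) → sound a , ¬j
  ; covers = λ (a , ¬j) → Sum.map (_, ¬j) (_, ¬j ∘ joins-sym e) (covers a)
  ; asym   = λ (a , _) (b , _) → asym a b
  }
  where open Orientation φ

-- Weaker than the library's Transitive: only distinct vertices are tested.
TransitiveDigraph : {V : Set} → Rel V 0ℓ → Set
TransitiveDigraph _⟶_ =
  ∀ {a b c} → a ≢ b → b ≢ c → a ≢ c → a ⟶ b → b ⟶ c → a ⟶ c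

module _ {V : Set} (_⟶_ : Rel V 0ℓ) where

  -- A directed path with k arcs on the k + 1 distinct vertices v 0, …, v k.
  record IsDirectedPath {k : ℕ} (v : Fin (sucℕ k) → V) : Set where
    field
      distinct : Injective _≡_ _≡_ v
      arcs     : ∀ (i : Fin k) → v (inject₁ i) ⟶ v (suc i)

  record DirectedCycle : Set where
    field
      {k}    : ℕ
      v      : Fin (sucℕ k) → V
      isPath : IsDirectedPath v
      closes : v (fromℕ k) ⟶ v zero

  Acyclic : Set
  Acyclic = ¬ DirectedCycle

  record Shortcut : Set where
    field
      {k}           : ℕ
      4≤size        : 4 ≤ sucℕ k
      v             : Fin (sucℕ k) → V
      isPath        : IsDirectedPath v
      shortcutArc   : v zero ⟶ v (fromℕ k)
      -- As v is injective, pulling the arcs back along v gives the induced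
      -- subdigraph on {v 0, …, v k}, with each vertex named by its index.
      nonTransitive : ¬ TransitiveDigraph (_⟶_ on v)

record SemiTransitive {n : ℕ} {G : Graph n} (φ : Orientation G) : Set where
  open Orientation φ using (_⟶_)
  field
    acyclic     : Acyclic _⟶_
    noShortcuts : ¬ Shortcut _⟶_

{-# OPTIONS --safe #-}
-- Delete an arc a ⟶ b with no c such that a ⟶ c ⟶ b; one exists because the
-- orientation is acyclic: take b minimal among the out-neighbours of a.
-- A vertex set that becomes non-transitive when a ⟶ b is deleted must contain
-- such a c or have been non-transitive before, so every shortcut that remains
-- was already a shortcut.
module Submission where

open import Data.Fin using (Fin; zero; suc; inject₁; inject≤; fromℕ; toℕ)
open import Data.Fin.Properties
  using (any?; injective⇒≤; inject≤-injective; toℕ-injective; toℕ-inject≤;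
         toℕ-fromℕ; toℕ<n)
open import Data.Nat using (ℕ; _+_; _≤_; s≤s) renaming (zero to zeroℕ; suc to sucℕ)
open import Data.Nat.Properties using (≤-trans; m≤m+n; +-suc; 1+n≰n)
open import Data.Product using (Σ-syntax; ∃-syntax; _×_; _,_; proj₁)
open import Data.Sum using (inj₁; inj₂)
open import Function using (_∘_)
open import Function.Definitions using (Injective)
open import Level using (0ℓ)
open import Relation.Binary.Core using (Rel; _⇒_)
open import Relation.Binary.Definitions using (Decidable)
open import Relation.Binary.PropositionalEquality
  using (_≡_; _≢_; refl; sym; trans; cong; subst)
open import Relation.Nullary using (¬_; yes; no; contradiction)
open import Relation.Nullary.Decidable using (_×-dec_)
open import Relation.Unary as Unary using (Pred)

open import Defs

inject≤-inject₁ : ∀ {m n} (j : Fin m) .(m≤n : m ≤ n) .(1+m≤1+n : sucℕ m ≤ sucℕ n) →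
                  inject≤ (inject₁ j) 1+m≤1+n ≡ inject₁ (inject≤ j m≤n)
inject≤-inject₁ {n = sucℕ _} zero    _ _ = refl
inject≤-inject₁ {n = sucℕ _} (suc j) _ _ = cong suc (inject≤-inject₁ j _ _)

inject≤-fromℕ-toℕ : ∀ {n} (i : Fin n) .(le : sucℕ (toℕ i) ≤ n) →
                    inject≤ (fromℕ (toℕ i)) le ≡ i
inject≤-fromℕ-toℕ i le =
  toℕ-injective (trans (toℕ-inject≤ _ le) (toℕ-fromℕ (toℕ i)))

module _ {V : Set} {R S : Rel V 0ℓ} (R⇒S : R ⇒ S) where

  isDirectedPath-map : ∀ {k} {v : Fin (sucℕ k) → V} →
                       IsDirectedPath R v → IsDirectedPath S v
  isDirectedPath-map p = record { distinct = distinct ; arcs = R⇒S ∘ arcs }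
    where open IsDirectedPath p

  acyclic-anti : Acyclic S → Acyclic R
  acyclic-anti acyclic c = acyclic record
    { v = v ; isPath = isDirectedPath-map isPath ; closes = R⇒S closes }
    where open DirectedCycle c

module _ {V : Set} {R : Rel V 0ℓ} where

  prefix : ∀ {k m} {v : Fin (sucℕ k) → V} (m≤k : m ≤ k) → IsDirectedPath R v →
           IsDirectedPath R (λ j → v (inject≤ j (s≤s m≤k)))
  prefix {v = v} m≤k p = record
    { distinct = λ eq → inject≤-injective _ _ _ _ (distinct eq)
    -- Only the source index needs transport: `inject≤` computes on `suc j`, but is stuck on
    -- `inject₁ j`.
    ; arcs     = λ j → subst (λ i → R (v i) (v (suc (inject≤ j m≤k))))
                             (sym (inject≤-inject₁ j m≤k (s≤s m≤k)))
                             (arcs (inject≤ j m≤k))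
    }
    where open IsDirectedPath p

  -- The arc would close the prefix ending at `v i` into a directed cycle; for `i = zero` that cycle
  -- is a loop on one vertex.
  acyclic⇒no-back-arc : ∀ {k} {v : Fin (sucℕ k) → V} → Acyclic R →
                        IsDirectedPath R v → ∀ i → ¬ R (v i) (v zero)
  acyclic⇒no-back-arc {v = v} acyclic p i r with toℕ<n i
  ... | s≤s i≤k = acyclic record
    { isPath = prefix i≤k p
    ; closes = subst (λ j → R (v j) (v zero)) (sym (inject≤-fromℕ-toℕ i (s≤s i≤k))) r
    }

  acyclic⇒cons : ∀ {k} {v : Fin (sucℕ k) → V} {u} → Acyclic R → R u (v zero) →
                 IsDirectedPath R v → Σ[ w ∈ (Fin (sucℕ (sucℕ k)) → V) ]
                                      w zero ≡ u × IsDirectedPath R w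
  acyclic⇒cons {k} {v} {u} acyclic r p =
    w , refl , record { distinct = w-injective ; arcs = w-arcs }
    where
    open IsDirectedPath p

    w : Fin (sucℕ (sucℕ k)) → V
    w zero    = u
    w (suc i) = v i

    -- If `u` were `v i`, then `r` would be an arc from the path back to its start.
    fresh : ∀ i → u ≢ v i
    fresh i refl = acyclic⇒no-back-arc acyclic p i r

    w-injective : Injective _≡_ _≡_ w
    w-injective {zero}  {zero}  _  = refl
    w-injective {zero}  {suc j} eq = contradiction eq (fresh j)
    w-injective {suc i} {zero}  eq = contradiction (sym eq) (fresh i)
    w-injective {suc i} {suc j} eq = cong suc (distinct eq)

    w-arcs : ∀ i → R (w (inject₁ i)) (w (suc i))
    w-arcs zero    = r
    w-arcs (suc i) = arcs i

module _ {n} {R : Rel (Fin n) 0ℓ} (R? : Decidable R) (acyclic : Acyclic R)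
         {P : Pred (Fin n) 0ℓ} (P? : Unary.Decidable P) where

  -- Grow a directed path backwards inside P; it has at most n vertices.
  acyclic⇒minimal : ∀ {b} → P b → ∃[ c ] P c × (∀ {d} → P d → ¬ R d c)
  acyclic⇒minimal {b} Pb = extend n (λ _ → b) Pb (m≤m+n n 0) record
    { distinct = λ { {zero} {zero} _ → refl } ; arcs = λ () }
    where
    extend : ∀ fuel {k} (v : Fin (sucℕ k) → Fin n) → P (v zero) →
             n ≤ fuel + k → IsDirectedPath R v →
             ∃[ c ] P c × (∀ {d} → P d → ¬ R d c)
    -- The path has `k + 1` distinct vertices, so running out of fuel would give `k + 1 ≤ n ≤ k`.
    extend zeroℕ v _ n≤k p =
      contradiction (≤-trans (injective⇒≤ (IsDirectedPath.distinct p)) n≤k) 1+n≰n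
    extend (sucℕ fuel) {k} v Pv n≤ p with any? (λ d → P? d ×-dec R? d (v zero))
    ... | no  none = v zero , Pv , λ Pd r → none (_ , Pd , r)
    ... | yes (d , Pd , r) with acyclic⇒cons acyclic r p
    -- Matching `refl` replaces `d` by `w zero`, so `Pd` is the invariant for the longer path.
    ... | w , refl , q = extend fuel w Pd (subst (n ≤_) (sym (+-suc fuel k)) n≤) q

module _ {n} {G : Graph n} (φ : Orientation G) where
  open Graph G using (adj?)
  open Orientation φ

  -- Adjacency is decidable, `covers` picks a direction for each edge, and `asym` refutes the other.
  arc? : Decidable _⟶_
  arc? u v with adj? u v
  ... | no  ¬uv = no (¬uv ∘ sound)
  ... | yes uv with covers uv
  ...   | inj₁ u⟶v = yes u⟶v
  ...   | inj₂ v⟶u = no (asym v⟶u)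

  restrict-semiTransitive : SemiTransitive φ → ∀ {a b} (a⟶b : a ⟶ b) →
    (∀ {c} → a ⟶ c → ¬ c ⟶ b) → SemiTransitive (restrict φ (edge (sound a⟶b)))
  restrict-semiTransitive st a⟶b no-middle = record
    { acyclic     = acyclic-anti proj₁ acyclic
    ; noShortcuts = λ s → let open Shortcut s in noShortcuts record
        { 4≤size        = 4≤size
        ; v             = v
        ; isPath        = isDirectedPath-map proj₁ isPath
        ; shortcutArc   = proj₁ shortcutArc
        -- By contraposition: transitivity on the vertices of `v` survives the deletion, since a
        -- composite arc is never the deleted one.
        ; nonTransitive = λ transitive → nonTransitive
            λ x≢y y≢z x≢z (x⟶y , _) (y⟶z , _) →
              let x⟶z = transitive x≢y y≢z x≢z x⟶y y⟶z in
              x⟶z , transitive-arc-kept x⟶y y⟶z x⟶z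
        }
    }
    where
    open SemiTransitive st

    transitive-arc-kept : ∀ {x y z} → x ⟶ y → y ⟶ z → x ⟶ z →
                          ¬ Joins {G = G} (edge (sound a⟶b)) x z
    transitive-arc-kept x⟶y y⟶z _   (inj₁ (refl , refl)) = no-middle x⟶y y⟶z
    -- `Joins` ignores direction, so the reversed pair must be excluded as well.
    transitive-arc-kept _   _   x⟶z (inj₂ (refl , refl)) = asym a⟶b x⟶z

  remove-arc : SemiTransitive φ → ∀ {a b} → a ⟶ b →
               Σ[ e ∈ Edge G ] SemiTransitive (restrict φ e)
  remove-arc st {a} a⟶b
    -- The set is the out-neighbourhood of `a`, which contains `b`. Minimality of its element `c`
    -- says exactly that no `d` satisfies `a ⟶ d ⟶ c`.
    with _ , a⟶c , minimal ← acyclic⇒minimal arc? (SemiTransitive.acyclic st) (arc? a) a⟶b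
    = edge (sound a⟶c) , restrict-semiTransitive st a⟶c minimal

theorem1p7 : ∀ {n : ℕ} (G : Graph n) → Edge G →
    (φ : Orientation G) → SemiTransitive φ →
    Σ[ e ∈ Edge G ] SemiTransitive (restrict φ e)
theorem1p7 G (edge adjacent) φ st with Orientation.covers φ adjacent
-- The given edge supplies a starting arc; the deleted arc has the same tail but possibly another
-- head.
... | inj₁ a⟶b = remove-arc φ st a⟶b
... | inj₂ b⟶a = remove-arc φ st b⟶a
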